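{- Let $n\ge 1$, $\Sigma_n=\{a_1,\dots,a_n\}$, and $L_n := L\big(\bigcup_{i\in[n]} (a_1\cup\cdots\cup a_{i-1}\cup a_i^2\cup a_{i+1}\cup\cdots\cup a_n)^*\big)$, i.e. $L_n$ is the set of words $w\in\Sigma_n^*$ for which there exists $i\in[n]$ such that every maximal block of consecutive $a_i$'s in $w$ has even length. Then every RE over star-free expression $R_n$ with $L(R_n)=L_n$ contains at least $n$ occurrences of the star operator.
   Context: $[n]=\{1,\dots,n\}$. Generalized regular expressions over an alphabet are built from $\emptyset$, $\epsilon$, letters, union $\cup$, catenation, star ${}^*$ and complement $\neg$, with $L(\neg R)=\Sigma^*\setminus L(R)$ and otherwise the usual semantics. RE over star-free expressions are the expressions generated by $R$ in the grammar $R ::= R\cup R \mid RR \mid R^* \mid S$, $S ::= S\cup S \mid SS \mid \neg S \mid \emptyset \mid \epsilon \mid a$ (for each letter $a$); i.e. star-free expressions with complement combined using union, catenation and star, with no star occurring inside a complement. -}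

module Defs where

open import Data.Nat using (ℕ; zero; suc; _+_)
open import Data.Fin using (Fin; _≟_)
open import Data.List using (List; []; _∷_; _++_; foldr; map; allFin)
open import Data.Product using (Σ; _×_; _,_)
open import Data.Sum using (_⊎_)
open import Data.Empty using (⊥)
open import Data.Unit using (⊤)
open import Relation.Nullary using (¬_; yes; no)
open import Relation.Binary.PropositionalEquality using (_≡_)

data GRE (A : Set) : Set where
  ∅    : GRE A
  ε    : GRE A
  sym  : A → GRE A
  _∪_  : GRE A → GRE A → GRE A
  _·_  : GRE A → GRE A → GRE A
  _*   : GRE A → GRE A
  ¬ᵣ_  : GRE A → GRE A

Lang : Set → Set₁
Lang A = List A → Set

data Star {A : Set} (L : Lang A) : Lang A where
  nil  : Star L []
  cons : ∀ {u v} → L u → Star L v → Star L (u ++ v)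

⟦_⟧ : {A : Set} → GRE A → Lang A
⟦ ∅ ⟧ w = ⊥
⟦ ε ⟧ w = w ≡ []
⟦ sym a ⟧ w = w ≡ (a ∷ [])
⟦ r ∪ s ⟧ w = ⟦ r ⟧ w ⊎ ⟦ s ⟧ w
⟦ r · s ⟧ w = Σ _ λ u → Σ _ λ v → (w ≡ u ++ v) × ⟦ r ⟧ u × ⟦ s ⟧ v
⟦ r * ⟧ w = Star ⟦ r ⟧ w
⟦ ¬ᵣ r ⟧ w = ¬ (⟦ r ⟧ w)

starCount : {A : Set} → GRE A → ℕ
starCount ∅ = 0
starCount ε = 0
starCount (sym a) = 0
starCount (r ∪ s) = starCount r + starCount s
starCount (r · s) = starCount r + starCount s
starCount (r *) = suc (starCount r)
starCount (¬ᵣ r) = starCount r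

data StarFree {A : Set} : GRE A → Set where
  sf∅   : StarFree ∅
  sfε   : StarFree ε
  sfsym : ∀ a → StarFree (sym a)
  sf∪   : ∀ {r s} → StarFree r → StarFree s → StarFree (r ∪ s)
  sf·   : ∀ {r s} → StarFree r → StarFree s → StarFree (r · s)
  sf¬   : ∀ {r} → StarFree r → StarFree (¬ᵣ r)

data REoverSF {A : Set} : GRE A → Set where
  base : ∀ {r} → StarFree r → REoverSF r
  re∪  : ∀ {r s} → REoverSF r → REoverSF s → REoverSF (r ∪ s)
  re·  : ∀ {r s} → REoverSF r → REoverSF s → REoverSF (r · s)
  re*  : ∀ {r} → REoverSF r → REoverSF (r *)

⋃ : {A : Set} → List (GRE A) → GRE A
⋃ = foldr _∪_ ∅

letterOrSquare : (n : ℕ) → Fin n → Fin n → GRE (Fin n)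
letterOrSquare n i j with j ≟ i
... | yes _ = sym j · sym j
... | no  _ = sym j

Lexpr : (n : ℕ) → GRE (Fin n)
Lexpr n = ⋃ (map (λ i → (⋃ (map (letterOrSquare n i) (allFin n))) *) (allFin n))

Ln : (n : ℕ) → Lang (Fin n)
Ln n = ⟦ Lexpr n ⟧

{-# OPTIONS --safe #-}

-- For each letter i let uᵢ be a long even power of i followed by a word whose i-blocks are even and
-- which has an isolated occurrence of every other letter.  A large power of uᵢ lies in Lₙ, hence in
-- L(R).  Splitting it along R without entering the stars yields boundedly many pieces, so some
-- piece contains a whole uᵢ.  That piece does not come from a star-free expression, for aperiodicity
-- would allow inserting one more i, leaving Lₙ; so it comes from some starred subexpression of R.
-- If the same star served i ≠ j, it would also match a word containing both uᵢ and uⱼ, and L(R)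
-- would contain a word with an odd block of every letter.  Thus the choice of stars is injective.
module Submission where

open import Defs
open import Data.Nat using (ℕ; zero; suc; _+_; _∸_; _≤_; s≤s)
  renaming (_*_ to _×ℕ_)
open import Data.Nat.Properties
  using (≤-trans; ≤-refl; m≤m+n; m≤n+m; n≤1+n; m≤m*n; <-irrefl; <-≤-trans;
         +-monoʳ-≤; +-monoˡ-≤; <⇒≤; ≮⇒≥; m+n≤o⇒m≤o; m+n≤o⇒n≤o;
         m+[n∸m]≡n; m∸n+n≡m; _<?_; +-suc; +-comm; +-mono-<;
         m+n≤o⇒m≤o∸n)
open import Data.Fin using (Fin; zero; join; splitAt; _≟_)
open import Data.Fin.Properties using (splitAt-join; injective⇒≤)
open import Data.List using (List; []; _∷_; _++_; concatMap; replicate; map; allFin)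
open import Data.List.Properties using (++-assoc; ++-identityʳ; ∷-injective)
open import Data.List.Membership.Propositional using (_∈_)
open import Data.List.Membership.Propositional.Properties using (∈-allFin)
open import Data.List.Relation.Unary.Any using (here; there)
open import Data.Product using (∃; ∃₂; _×_; _,_)
open import Data.Sum using (_⊎_; inj₁; inj₂; [_,_])
import Data.Sum as Sum
open import Data.Sum.Properties using (inj₁-injective; inj₂-injective)
open import Data.Empty using (⊥; ⊥-elim)
open import Data.Unit using (⊤; tt)
open import Function using (_∘_)
open import Function.Bundles using (_⇔_; Equivalence)
open import Relation.Nullary using (¬_; yes; no; contradiction)
open import Relation.Binary.PropositionalEquality as ≡
  using (_≡_; _≢_; refl; cong; subst; module ≡-Reasoning)

private
  variable
    A : Set

-- Factors, powers and splittings of words.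

Factor : List A → List A → Set
Factor v w = ∃₂ λ p q → w ≡ p ++ v ++ q

factor-trans : {u v w : List A} → Factor u v → Factor v w → Factor u w
factor-trans {u = u} (p , q , refl) (p′ , q′ , refl) = p′ ++ p , q ++ q′ , (begin
  p′ ++ (p ++ u ++ q) ++ q′   ≡⟨ cong (p′ ++_) (++-assoc p (u ++ q) q′) ⟩
  p′ ++ p ++ (u ++ q) ++ q′   ≡⟨ cong (λ x → p′ ++ p ++ x) (++-assoc u q q′) ⟩
  p′ ++ p ++ u ++ q ++ q′     ≡⟨ ++-assoc p′ p (u ++ q ++ q′) ⟨
  (p′ ++ p) ++ u ++ q ++ q′   ∎)
  where open ≡-Reasoning

factor-prefix : (u v : List A) → Factor u (u ++ v)
factor-prefix u v = [] , v , refl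

factor-suffix : (u v : List A) → Factor v (u ++ v)
factor-suffix u v = u , [] , cong (u ++_) (≡.sym (++-identityʳ v))

factor-concatMap : {B : Set} (f : B → List A) {x : B} {xs : List B} →
  x ∈ xs → Factor (f x) (concatMap f xs)
factor-concatMap f {xs = x ∷ xs} (here refl) = factor-prefix (f x) (concatMap f xs)
factor-concatMap f {xs = y ∷ xs} (there x∈xs) =
  factor-trans (factor-concatMap f x∈xs) (factor-suffix (f y) (concatMap f xs))

++-split : (p : List A) {q : List A} (u : List A) {v : List A} → p ++ q ≡ u ++ v →
  (∃ λ t → u ≡ p ++ t × q ≡ t ++ v) ⊎ (∃ λ t → p ≡ u ++ t × v ≡ t ++ q)
++-split []      u       eq = inj₁ (u , refl , eq)
++-split (x ∷ p) []      eq = inj₂ (x ∷ p , refl , ≡.sym eq)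
++-split (x ∷ p) (y ∷ u) eq with ∷-injective eq
... | refl , eq′ = Sum.map (λ (t , e , e′) → t , cong (x ∷_) e , e′)
                           (λ (t , e , e′) → t , cong (x ∷_) e , e′)
                           (++-split p u eq′)

-- If the cut between `u` and `v` falls at or after the end of `x`, then `x` lies in `u`; otherwise
-- all of `y` lies in `v`.
factor-split : (x y : List A) {u v : List A} → Factor (x ++ y) (u ++ v) → Factor x u ⊎ Factor y v
factor-split x y {u} {v} (p , q , eq)
  with ++-split (p ++ x) u (≡.trans (++-assoc p x (y ++ q))
         (≡.trans (cong (p ++_) (≡.sym (++-assoc x y q))) (≡.sym eq)))
... | inj₁ (t , e , _) = inj₁ (p , t , ≡.trans e (++-assoc p x t))
... | inj₂ (t , _ , e) = inj₂ (t , q , e)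

power : ℕ → List A → List A
power zero    u = []
power (suc k) u = u ++ power k u

power-+ : ∀ k l (u : List A) → power (k + l) u ≡ power k u ++ power l u
power-+ zero    l u = refl
power-+ (suc k) l u =
  ≡.trans (cong (u ++_) (power-+ k l u)) (≡.sym (++-assoc u (power k u) (power l u)))

factor-power : {k l : ℕ} (u : List A) → k ≤ l → Factor (power k u) (power l u)
factor-power {k = k} {l} u k≤l = [] , power (l ∸ k) u ,
  ≡.trans (cong (λ j → power j u) (≡.sym (m+[n∸m]≡n k≤l))) (power-+ k (l ∸ k) u)

replicate-+ : ∀ k l (a : A) → replicate (k + l) a ≡ replicate k a ++ replicate l a
replicate-+ zero    l a = refl
replicate-+ (suc k) l a = cong (a ∷_) (replicate-+ k l a)

replicate-split : ∀ m {a : A} (s : List A) {t : List A} → replicate m a ≡ s ++ t →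
  ∃₂ λ k l → k + l ≡ m × s ≡ replicate k a × t ≡ replicate l a
replicate-split m [] eq = 0 , m , refl , refl , ≡.sym eq
replicate-split (suc m) (x ∷ s) eq with ∷-injective eq
... | refl , eq′ with replicate-split m s eq′
...   | k , l , refl , refl , refl = suc k , l , refl , refl , refl

-- Star-free languages are aperiodic

-- Aperiodicity for powers of one letter. Allowing any two exponents from `N` on, instead of `m` and
-- `suc m`, makes the condition symmetric, as complements require.
AperiodicAt : A → ℕ → Lang A → Set
AperiodicAt a N L = ∀ {m m′} p q → N ≤ m → N ≤ m′ →
  L (p ++ replicate m a ++ q) → L (p ++ replicate m′ a ++ q)

-- Here `k` and `l` are the parts of a block cut by a concatenation, and `m′` is the new block
-- length. At most one part is below its bound; it is kept and the other takes the remainder. If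
-- neither is, `M` and `m′ ∸ M` serve.
rebalance : ∀ M N k l {m′} → M + N ≤ k + l → M + N ≤ m′ →
  ∃₂ λ k′ l′ → k′ + l′ ≡ m′ × (k ≡ k′ ⊎ M ≤ k × M ≤ k′) × (l ≡ l′ ⊎ N ≤ l × N ≤ l′)
rebalance M N k l {m′} h h′ with k <? M | l <? N
... | yes k<M | yes l<N = contradiction (<-≤-trans (+-mono-< k<M l<N) h) (<-irrefl refl)
... | yes k<M | no l≮N =
  k , m′ ∸ k , m+[n∸m]≡n (m+n≤o⇒m≤o k k+N≤m′) ,
  inj₁ refl , inj₂ (≮⇒≥ l≮N , m+n≤o⇒m≤o∸n N (subst (_≤ m′) (+-comm k N) k+N≤m′))
  where k+N≤m′ = ≤-trans (+-monoˡ-≤ N (<⇒≤ k<M)) h′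
... | no k≮M | yes l<N =
  m′ ∸ l , l , m∸n+n≡m (m+n≤o⇒n≤o M M+l≤m′) ,
  inj₂ (≮⇒≥ k≮M , m+n≤o⇒m≤o∸n M M+l≤m′) , inj₁ refl
  where M+l≤m′ = ≤-trans (+-monoʳ-≤ M (<⇒≤ l<N)) h′
... | no k≮M | no l≮N =
  M , m′ ∸ M , m+[n∸m]≡n (m+n≤o⇒m≤o M h′) ,
  inj₂ (≮⇒≥ k≮M , ≤-refl) ,
  inj₂ (≮⇒≥ l≮N , m+n≤o⇒m≤o∸n N (subst (_≤ m′) (+-comm M N) h′))

infix-split : ∀ m {a : A} p q u v → p ++ replicate m a ++ q ≡ u ++ v →
  (∃ λ t → p ≡ u ++ t × v ≡ t ++ replicate m a ++ q) ⊎
  (∃ λ t → u ≡ p ++ replicate m a ++ t × q ≡ t ++ v) ⊎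
  (∃₂ λ k l → k + l ≡ m × u ≡ p ++ replicate k a × v ≡ replicate l a ++ q)
infix-split m {a} p q u v eq with ++-split p u eq
... | inj₂ x = inj₁ x
... | inj₁ (s , refl , eq′) with ++-split (replicate m a) s eq′
...   | inj₁ (t , refl , eq″) = inj₂ (inj₁ (t , refl , eq″))
...   | inj₂ (t , eq″ , refl) with replicate-split m s eq″
...     | k , l , refl , refl , refl = inj₂ (inj₂ (k , l , refl , refl , refl))

aperiodic-· : ∀ {a : A} {M N} r s → AperiodicAt a M ⟦ r ⟧ → AperiodicAt a N ⟦ s ⟧ →
  AperiodicAt a (M + N) ⟦ r · s ⟧
aperiodic-· {a = a} {M} {N} r s apʳ apˢ {m} {m′} p q h h′ (u , v , eq , ru , sv)
  with infix-split m p q u v eq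
... | inj₁ (t , refl , refl) =
  u , t ++ replicate m′ a ++ q , ++-assoc u t (replicate m′ a ++ q) ,
  ru , apˢ t q (m+n≤o⇒n≤o M h) (m+n≤o⇒n≤o M h′) sv
... | inj₂ (inj₁ (t , refl , refl)) =
  p ++ replicate m′ a ++ t , v ,
  ≡.trans (cong (p ++_) (≡.sym (++-assoc (replicate m′ a) t v)))
          (≡.sym (++-assoc p (replicate m′ a ++ t) v)) ,
  apʳ p t (m+n≤o⇒m≤o M h) (m+n≤o⇒m≤o M h′) ru , sv
-- The cut divides the block: each word either stays as it is or is changed by its own aperiodicity.
... | inj₂ (inj₂ (k , l , refl , refl , refl)) with rebalance M N k l h h′
...   | k′ , l′ , refl , hk , hl =
  p ++ replicate k′ a , replicate l′ a ++ q , eq′ , ru′ hk , sv′ hl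
  where
  eq′ : p ++ replicate (k′ + l′) a ++ q ≡ (p ++ replicate k′ a) ++ replicate l′ a ++ q
  eq′ = begin
    p ++ replicate (k′ + l′) a ++ q
      ≡⟨ cong (λ x → p ++ x ++ q) (replicate-+ k′ l′ a) ⟩
    p ++ (replicate k′ a ++ replicate l′ a) ++ q
      ≡⟨ cong (p ++_) (++-assoc (replicate k′ a) (replicate l′ a) q) ⟩
    p ++ replicate k′ a ++ replicate l′ a ++ q
      ≡⟨ ++-assoc p (replicate k′ a) (replicate l′ a ++ q) ⟨
    (p ++ replicate k′ a) ++ replicate l′ a ++ q ∎
    where open ≡-Reasoning
  ru′ : k ≡ k′ ⊎ M ≤ k × M ≤ k′ → ⟦ r ⟧ (p ++ replicate k′ a)
  ru′ (inj₁ refl) = ru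
  ru′ (inj₂ (i , j)) = subst (λ x → ⟦ r ⟧ (p ++ x)) (++-identityʳ (replicate k′ a))
    (apʳ p [] i j (subst (λ x → ⟦ r ⟧ (p ++ x)) (≡.sym (++-identityʳ (replicate k a))) ru))
  sv′ : l ≡ l′ ⊎ N ≤ l × N ≤ l′ → ⟦ s ⟧ (replicate l′ a ++ q)
  sv′ (inj₁ refl) = sv
  sv′ (inj₂ (i , j)) = apˢ [] q i j sv

-- Stars are never entered, so the value at r * is a dummy.
threshold : GRE A → ℕ
threshold ∅       = 0
threshold ε       = 1
threshold (sym _) = 2
threshold (r ∪ s) = threshold r + threshold s
threshold (r · s) = threshold r + threshold s
threshold (r *)   = 0
threshold (¬ᵣ r)  = threshold r

aperiodic : {a : A} {r : GRE A} → StarFree r → AperiodicAt a (threshold r) ⟦ r ⟧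
aperiodic sf∅ p q h h′ ()
-- For `ε` and letters the threshold exceeds the length of every matched word, so no match remains.
aperiodic sfε [] q (s≤s _) h′ ()
aperiodic sfε (_ ∷ p) q h h′ ()
aperiodic (sfsym a) [] q (s≤s (s≤s _)) h′ ()
aperiodic (sfsym a) (_ ∷ []) q (s≤s _) h′ ()
aperiodic (sfsym a) (_ ∷ _ ∷ p) q h h′ ()
aperiodic (sf∪ {r} {s} sr ss) p q h h′ = Sum.map
  (aperiodic sr p q (m+n≤o⇒m≤o (threshold r) h) (m+n≤o⇒m≤o (threshold r) h′))
  (aperiodic ss p q (m+n≤o⇒n≤o (threshold r) h) (m+n≤o⇒n≤o (threshold r) h′))
aperiodic (sf· {r} {s} sr ss) = aperiodic-· r s (aperiodic sr) (aperiodic ss)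
-- Membership in `r` is transferred backwards, with `m` and `m′` exchanged.
aperiodic (sf¬ sr) p q h h′ ¬x x = ¬x (aperiodic sr p q h′ h x)

-- Outermost star occurrences

-- Positions rather than subexpressions, so equal starred subexpressions at different places stay
-- distinct. Complements contribute none, since in an RE over star-free expressions no star lies
-- under a complement.
OuterStar : GRE A → Set
OuterStar ∅       = ⊥
OuterStar ε       = ⊥
OuterStar (sym _) = ⊥
OuterStar (r ∪ s) = OuterStar r ⊎ OuterStar s
OuterStar (r · s) = OuterStar r ⊎ OuterStar s
OuterStar (r *)   = ⊤
OuterStar (¬ᵣ r)  = ⊥

body : (r : GRE A) → OuterStar r → GRE A
body (r ∪ s) = [ body r , body s ]
body (r · s) = [ body r , body s ]
body (r *) _ = r

index : (r : GRE A) → OuterStar r → Fin (starCount r)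
index (r ∪ s) = join _ _ ∘ Sum.map (index r) (index s)
index (r · s) = join _ _ ∘ Sum.map (index r) (index s)
index (r *) _ = zero

join-injective : ∀ m n (x y : Fin m ⊎ Fin n) → join m n x ≡ join m n y → x ≡ y
join-injective m n x y eq =
  ≡.trans (≡.sym (splitAt-join m n x)) (≡.trans (cong (splitAt m) eq) (splitAt-join m n y))

sum-map-injective : {B C D E : Set} {f : B → D} {g : C → E} →
  (∀ {x y} → f x ≡ f y → x ≡ y) → (∀ {x y} → g x ≡ g y → x ≡ y) →
  ∀ x y → Sum.map f g x ≡ Sum.map f g y → x ≡ y
sum-map-injective fi gi (inj₁ x) (inj₁ y) eq = cong inj₁ (fi (inj₁-injective eq))
sum-map-injective fi gi (inj₂ x) (inj₂ y) eq = cong inj₂ (gi (inj₂-injective eq))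

index-injective : (r : GRE A) {o o′ : OuterStar r} → index r o ≡ index r o′ → o ≡ o′
index-injective (r ∪ s) eq = sum-map-injective (index-injective r) (index-injective s) _ _
  (join-injective (starCount r) (starCount s) _ _ eq)
index-injective (r · s) eq = sum-map-injective (index-injective r) (index-injective s) _ _
  (join-injective (starCount r) (starCount s) _ _ eq)
index-injective (r *) _ = refl

-- Splitting a matched word along an expression.

Context : (r : GRE A) → OuterStar r → List A → List A → Set
Context r o x z = ∀ {y} → Star ⟦ body r o ⟧ y → ⟦ r ⟧ (x ++ y ++ z)

-- The context admits every word of the star, not only the exhibited `y`; this allows `y` to be
-- exchanged for a longer word later.
StarCovers : GRE A → List A → Set
StarCovers r u = ∃ λ o → ∃₂ λ x z → Context r o x z × ∃ λ y → Factor u y × Star ⟦ body r o ⟧ y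

Inserted : A → ℕ → Lang A → Lang A
Inserted a m L w = ∃₂ λ p q → w ≡ p ++ replicate m a ++ q × L (p ++ replicate (suc m) a ++ q)

-- Bounds the number of cuts made by concatenations. A starred or complemented expression is left
-- whole, and at a union the sum bounds both alternatives.
cuts : GRE A → ℕ
cuts (r ∪ s) = cuts r + cuts s
cuts (r · s) = suc (cuts r + cuts s)
cuts _       = 0

covers-∪ˡ : ∀ {r s : GRE A} {u} → StarCovers r u → StarCovers (r ∪ s) u
covers-∪ˡ (o , x , z , ctx , c) = inj₁ o , x , z , (λ y∈ → inj₁ (ctx y∈)) , c

covers-∪ʳ : ∀ {r s : GRE A} {u} → StarCovers s u → StarCovers (r ∪ s) u
covers-∪ʳ (o , x , z , ctx , c) = inj₂ o , x , z , (λ y∈ → inj₂ (ctx y∈)) , c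

covers-·ˡ : ∀ {r s : GRE A} {u v} → ⟦ s ⟧ v → StarCovers r u → StarCovers (r · s) u
covers-·ˡ {v = v} v∈s (o , x , z , ctx , c) = inj₁ o , x , z ++ v , (λ {y} y∈ →
  x ++ y ++ z , v ,
  ≡.trans (cong (x ++_) (≡.sym (++-assoc y z v))) (≡.sym (++-assoc x (y ++ z) v)) ,
  ctx y∈ , v∈s) , c

covers-·ʳ : ∀ {r s : GRE A} {u v} → ⟦ r ⟧ v → StarCovers s u → StarCovers (r · s) u
covers-·ʳ {v = v} v∈r (o , x , z , ctx , c) = inj₂ o , v ++ x , z , (λ {y} y∈ →
  v , x ++ y ++ z , ++-assoc v x (y ++ z) , v∈r , ctx y∈) , c

inserted-·ˡ : ∀ {a : A} {m r s u v} → ⟦ s ⟧ v → Inserted a m ⟦ r ⟧ u →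
  Inserted a m ⟦ r · s ⟧ (u ++ v)
inserted-·ˡ {a = a} {m} {v = v} v∈s (p , q , refl , new) =
  p , q ++ v , reassoc m , p ++ replicate (suc m) a ++ q , v , ≡.sym (reassoc (suc m)) , new , v∈s
  where
  reassoc : ∀ k → (p ++ replicate k a ++ q) ++ v ≡ p ++ replicate k a ++ q ++ v
  reassoc k = ≡.trans (++-assoc p (replicate k a ++ q) v)
                      (cong (p ++_) (++-assoc (replicate k a) q v))

inserted-·ʳ : ∀ {a : A} {m r s u v} → ⟦ r ⟧ u → Inserted a m ⟦ s ⟧ v →
  Inserted a m ⟦ r · s ⟧ (u ++ v)
inserted-·ʳ {a = a} {m} {u = u} u∈r (p , q , refl , new) =
  u ++ p , q , ≡.sym (++-assoc u p (replicate m a ++ q)) ,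
  u , p ++ replicate (suc m) a ++ q , ++-assoc u p (replicate (suc m) a ++ q) , u∈r , new

-- Pigeonhole: `cuts r` cuts cannot damage all `suc (cuts r)` copies of `u`, so some piece contains
-- an intact copy. A star-free piece permits an insertion, a starred one covers `u`.
inserted-or-covered : ∀ {a : A} {m} v {r} → REoverSF r → threshold r ≤ m →
  let u = replicate m a ++ v in
  ∀ {w} → Factor (power (suc (cuts r)) u) w → ⟦ r ⟧ w → Inserted a m ⟦ r ⟧ w ⊎ StarCovers r u
inserted-or-covered {a = a} {m} v {r} (base sf) h {w} f w∈r
  with factor-trans (factor-prefix (replicate m a) v)
         (factor-trans (factor-prefix (replicate m a ++ v) (power (cuts r) (replicate m a ++ v))) f)
... | p , q , refl = inj₁ (p , q , refl , aperiodic sf p q h (≤-trans h (n≤1+n m)) w∈r)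
inserted-or-covered v (re∪ {r} {s} rr rs) h f (inj₁ w∈r) = Sum.map
  (λ (p , q , eq , new) → p , q , eq , inj₁ new) covers-∪ˡ
  (inserted-or-covered v rr (m+n≤o⇒m≤o (threshold r) h)
    (factor-trans (factor-power _ (s≤s (m≤m+n (cuts r) (cuts s)))) f) w∈r)
inserted-or-covered v (re∪ {r} {s} rr rs) h f (inj₂ w∈s) = Sum.map
  (λ (p , q , eq , new) → p , q , eq , inj₂ new) covers-∪ʳ
  (inserted-or-covered v rs (m+n≤o⇒n≤o (threshold r) h)
    (factor-trans (factor-power _ (s≤s (m≤n+m (cuts s) (cuts r)))) f) w∈s)
inserted-or-covered {a = a} {m} v (re· {r} {s} rr rs) h f (w₁ , w₂ , refl , w₁∈r , w₂∈s)
  with factor-split (power (suc (cuts r)) u) (power (suc (cuts s)) u)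
         (subst (λ x → Factor x (w₁ ++ w₂)) powers f)
  where
  u = replicate m a ++ v
  -- The extra `suc` in `cuts (r · s)` makes the copies divide into exactly those that the two
  -- recursive calls ask for.
  powers : power (suc (suc (cuts r + cuts s))) u ≡ power (suc (cuts r)) u ++ power (suc (cuts s)) u
  powers = ≡.trans (cong (λ k → power (suc k) u) (≡.sym (+-suc (cuts r) (cuts s))))
                   (power-+ (suc (cuts r)) (suc (cuts s)) u)
... | inj₁ f₁ = Sum.map (inserted-·ˡ {r = r} {s} w₂∈s) (covers-·ˡ w₂∈s)
  (inserted-or-covered v rr (m+n≤o⇒m≤o (threshold r) h) f₁ w₁∈r)
... | inj₂ f₂ = Sum.map (inserted-·ʳ {r = r} {s} w₁∈r) (covers-·ʳ w₁∈r)
  (inserted-or-covered v rs (m+n≤o⇒n≤o (threshold r) h) f₂ w₂∈s)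
-- The star matches all of `w`, so the context is empty and one copy of `u` is enough.
inserted-or-covered {a = a} {m} v (re* {r} rr) h {w} f w∈r* = inj₂
  (tt , [] , [] , (λ {y} → subst (Star ⟦ r ⟧) (≡.sym (++-identityʳ y))) ,
   w , factor-trans (factor-prefix (replicate m a ++ v) []) f , w∈r*)

-- Membership in finite unions.

⋃⁺ : {B : Set} (f : B → GRE A) {x : B} {xs : List B} {u : List A} →
  x ∈ xs → ⟦ f x ⟧ u → ⟦ ⋃ (map f xs) ⟧ u
⋃⁺ f (here refl) h = inj₁ h
⋃⁺ f (there x∈)  h = inj₂ (⋃⁺ f x∈ h)

⋃⁻ : {B : Set} (f : B → GRE A) (xs : List B) {u : List A} →
  ⟦ ⋃ (map f xs) ⟧ u → ∃ λ x → ⟦ f x ⟧ u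
⋃⁻ f (x ∷ xs) (inj₁ h) = x , h
⋃⁻ f (x ∷ xs) (inj₂ h) = ⋃⁻ f xs h

-- Even blocks

-- Because `other` excludes `i`, each `i` must be consumed by `pair`, which lets odd blocks be
-- refuted by case analysis.
data EvenBlocks {n : ℕ} (i : Fin n) : List (Fin n) → Set where
  []    : EvenBlocks i []
  pair  : ∀ {w} → EvenBlocks i w → EvenBlocks i (i ∷ i ∷ w)
  other : ∀ {j w} → j ≢ i → EvenBlocks i w → EvenBlocks i (j ∷ w)

module _ {n : ℕ} where

  private
    variable
      i j k : Fin n
      p q w : List (Fin n)

  ++⁺ : EvenBlocks i p → EvenBlocks i q → EvenBlocks i (p ++ q)
  ++⁺ []          e′ = e′
  ++⁺ (pair e)    e′ = pair (++⁺ e e′)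
  ++⁺ (other x e) e′ = other x (++⁺ e e′)

  power⁺ : ∀ m → EvenBlocks i w → EvenBlocks i (power m w)
  power⁺ zero    e = []
  power⁺ (suc m) e = ++⁺ e (power⁺ m e)

  -- A letter other than `i` ends a block, so no `pair` straddles it.
  cut : ∀ p → j ≢ i → EvenBlocks i (p ++ j ∷ q) → EvenBlocks i p × EvenBlocks i q
  cut []          j≢i (pair e)    = contradiction refl j≢i
  cut []          j≢i (other _ e) = [] , e
  cut (_ ∷ [])    j≢i (pair e)    = contradiction refl j≢i
  cut (_ ∷ _ ∷ p) j≢i (pair e)    with cut p j≢i e
  ... | e₁ , e₂ = pair e₁ , e₂
  cut (_ ∷ p)     j≢i (other x e) with cut p j≢i e
  ... | e₁ , e₂ = other x e₁ , e₂

  -- The leading block would have both parities. Each step drops one `i` and exchanges the roles of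
  -- the two derivations.
  ¬even-∷ : EvenBlocks i w → ¬ EvenBlocks i (i ∷ w)
  ¬even-∷ e (other i≢i _) = i≢i refl
  ¬even-∷ e (pair e′)     = ¬even-∷ e′ e

  ¬even-insert : ∀ p → EvenBlocks i (p ++ q) → ¬ EvenBlocks i (p ++ i ∷ q)
  ¬even-insert []          e             e′            = ¬even-∷ e e′
  ¬even-insert (_ ∷ [])    (pair e)      (pair e′)     = ¬even-∷ e e′
  ¬even-insert (_ ∷ [])    (pair _)      (other i≢i _) = i≢i refl
  ¬even-insert (_ ∷ [])    (other i≢i _) (pair _)      = i≢i refl
  ¬even-insert (_ ∷ [])    (other _ e)   (other _ e′)  = ¬even-∷ e e′
  ¬even-insert (_ ∷ _ ∷ p) (pair e)      (pair e′)     = ¬even-insert p e e′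
  ¬even-insert (_ ∷ _ ∷ p) (pair _)      (other i≢i _) = i≢i refl
  ¬even-insert (_ ∷ _ ∷ p) (other i≢i _) (pair _)      = i≢i refl
  ¬even-insert (_ ∷ y ∷ p) (other _ e)   (other _ e′)  = ¬even-insert (y ∷ p) e e′

  ¬even-isolated : i ≢ k → Factor (i ∷ k ∷ i ∷ []) w → ¬ EvenBlocks k w
  ¬even-isolated {k = k} i≢k (p , q , refl) e with cut p i≢k e
  ... | _ , e₁ with cut (k ∷ []) i≢k e₁
  ...   | e₂ , _ = ¬even-∷ [] e₂

  -- For j = i this is i⁶, and for j ≠ i it contains an isolated j enclosed by i's.
  isolating : Fin n → Fin n → List (Fin n)
  isolating i j = i ∷ i ∷ j ∷ i ∷ i ∷ j ∷ []

  allIsolating : Fin n → List (Fin n)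
  allIsolating i = concatMap (isolating i) (allFin n)

  even-isolating : ∀ i j → EvenBlocks i (isolating i j)
  even-isolating i j with j ≟ i
  ... | yes refl = pair (pair (pair []))
  ... | no  j≢i  = pair (other j≢i (pair (other j≢i [])))

  even-concatMap : (f : Fin n → List (Fin n)) → (∀ j → EvenBlocks i (f j)) →
    ∀ js → EvenBlocks i (concatMap f js)
  even-concatMap f e []       = []
  even-concatMap f e (j ∷ js) = ++⁺ (e j) (even-concatMap f e js)

  even-replicate : ∀ m → EvenBlocks i (replicate (m ×ℕ 2) i)
  even-replicate zero    = []
  even-replicate (suc m) = pair (even-replicate m)

  -- For each `k ≢ i` the word `allIsolating i` contains `i k i`, a `k`-block of length one.
  even-allIsolating⇒≡ : Factor (allIsolating i) w → EvenBlocks k w → k ≡ i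
  even-allIsolating⇒≡ {i = i} {k = k} f e with i ≟ k
  ... | yes i≡k = ≡.sym i≡k
  ... | no  i≢k = contradiction e (¬even-isolated i≢k
    (factor-trans (i ∷ [] , i ∷ k ∷ [] , refl)
      (factor-trans (factor-concatMap (isolating i) (∈-allFin k)) f)))

  pair∈ : ∀ i → ⟦ letterOrSquare n i i ⟧ (i ∷ i ∷ [])
  pair∈ i with i ≟ i
  ... | yes _  = i ∷ [] , i ∷ [] , refl , refl , refl
  ... | no i≢i = contradiction refl i≢i

  other∈ : j ≢ i → ⟦ letterOrSquare n i j ⟧ (j ∷ [])
  other∈ {j} {i} j≢i with j ≟ i
  ... | yes j≡i = contradiction j≡i j≢i
  ... | no  _   = refl

  piece-++ : ∀ i j {u} → ⟦ letterOrSquare n i j ⟧ u → EvenBlocks i w → EvenBlocks i (u ++ w)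
  piece-++ i j h e with j ≟ i
  piece-++ i j (_ , _ , refl , refl , refl) e | yes refl = pair e
  piece-++ i j refl                         e | no j≢i   = other j≢i e

  Ln⇒even : Ln n w → ∃ λ i → EvenBlocks i w
  Ln⇒even h with ⋃⁻ _ (allFin n) h
  ... | i , h′ = i , go h′
    where
    go : ∀ {w} → Star ⟦ ⋃ (map (letterOrSquare n i) (allFin n)) ⟧ w → EvenBlocks i w
    go nil        = []
    go (cons x s) with ⋃⁻ (letterOrSquare n i) (allFin n) x
    ... | j , x′ = piece-++ i j x′ (go s)

  even⇒Ln : EvenBlocks i w → Ln n w
  even⇒Ln {i = i} e = ⋃⁺ _ (∈-allFin i) (go e)
    where
    go : ∀ {w} → EvenBlocks i w → Star ⟦ ⋃ (map (letterOrSquare n i) (allFin n)) ⟧ w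
    go []              = nil
    go (pair e)        = cons (⋃⁺ (letterOrSquare n i) (∈-allFin i) (pair∈ i)) (go e)
    go (other {j} x e) = cons (⋃⁺ (letterOrSquare n i) (∈-allFin j) (other∈ x)) (go e)

  ¬even-inserted : ∀ {m} → EvenBlocks i w → Factor (allIsolating i) w →
    ¬ Inserted i m (Ln n) w
  ¬even-inserted {i = i} {m = m} e f (p , q , refl , new) with Ln⇒even new
  ... | k , e′ with k ≟ i
  ...   | yes refl = ¬even-insert p e e′
  -- Deleting the inserted `i` may join two `k`-blocks, but the sum of even lengths is even. So the
  -- original word has even `k`-blocks, although it isolates `k`.
  ...   | no  k≢i  with cut p (k≢i ∘ ≡.sym) e′
  ...     | e₁ , e₂ = k≢i (even-allIsolating⇒≡ f (++⁺ e₁ e₂))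

-- The injection of letters into outermost stars.

star-++ : {L : Lang A} {u v : List A} → Star L u → Star L v → Star L (u ++ v)
star-++ nil t = t
star-++ {L = L} {v = v} (cons {u} {u′} x s) t =
  subst (Star L) (≡.sym (++-assoc u u′ v)) (cons x (star-++ s t))

module _ {n : ℕ} (R : GRE (Fin n)) (R∈ : REoverSF R)
         (R≡Ln : (w : List (Fin n)) → ⟦ R ⟧ w ⇔ Ln n w) where

  -- Doubling makes the block even while keeping it at least as long as the threshold.
  m : ℕ
  m = threshold R ×ℕ 2

  star-covers : ∀ i → StarCovers R (replicate m i ++ allIsolating i)
  star-covers i = Sum.fromInj₂ (⊥-elim ∘ ¬inserted)
    (inserted-or-covered (allIsolating i) R∈ (m≤m*n (threshold R) 2)
      ([] , [] , ≡.sym (++-identityʳ w))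
      (Equivalence.from (R≡Ln w) (even⇒Ln even-w)))
    where
    u = replicate m i ++ allIsolating i
    w = power (suc (cuts R)) u
    even-w : EvenBlocks i w
    even-w = power⁺ (suc (cuts R)) (++⁺ (even-replicate (threshold R))
      (even-concatMap (isolating i) (even-isolating i) (allFin n)))
    ¬inserted : ¬ Inserted i m ⟦ R ⟧ w
    ¬inserted (p , q , eq , new) = ¬even-inserted even-w
      (factor-trans (factor-suffix (replicate m i) _) (factor-prefix u (power (cuts R) u)))
      (p , q , eq , Equivalence.to (R≡Ln _) new)

  star : Fin n → OuterStar R
  star i with star-covers i
  ... | o , _ = o

  star-injective : ∀ {i j} → star i ≡ star j → i ≡ j
  star-injective {i} {j} eq with star-covers i | star-covers j
  star-injective {i} {j} refl | o , x , z , ctx , y , f , y∈ | .o , _ , _ , _ , y′ , f′ , y′∈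
    -- Both letters share the star, so it also matches `y ++ y′`, and the context found for `i`
    -- places this word in `R`. The letter `k` with even blocks must then equal both `i` and `j`.
    with Ln⇒even (Equivalence.to (R≡Ln _) (ctx (star-++ y∈ y′∈)))
  ... | k , e = ≡.trans
    (≡.sym (even-allIsolating⇒≡ (within i (factor-trans f (factor-prefix y y′))) e))
    (even-allIsolating⇒≡ (within j (factor-trans f′ (factor-suffix y y′))) e)
    where
    within : ∀ i → Factor (replicate m i ++ allIsolating i) (y ++ y′) →
      Factor (allIsolating i) (x ++ (y ++ y′) ++ z)
    within i g = factor-trans (factor-suffix (replicate m i) _) (factor-trans g (x , z , refl))

theorem9 : (n : ℕ) → 1 ≤ n → (R : GRE (Fin n)) → REoverSF R →
    ((w : List (Fin n)) → ⟦ R ⟧ w ⇔ Ln n w) → n ≤ starCount R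
theorem9 n _ R R∈ R≡Ln = injective⇒≤ (star-injective R R∈ R≡Ln ∘ index-injective R)
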